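{- Let $n\ge 1$ and let $I$ and $J$ be two compositions of $n$. Then $$\sum_{\substack{\sigma\in\mathfrak{S}_n\\ \mathrm{Rec}(\sigma)=I\\ \mathrm{GC}^0(\sigma)=J}} q^{\mathrm{tot}(\sigma)}\;=\;\sum_{\substack{\sigma\in\mathfrak{S}_n\\ \mathrm{Rec}(\sigma)=I\\ \mathrm{GC}(\sigma)=J}} q^{\mathrm{tot}(\sigma)}.$$
   Context: A composition of $n$ is a sequence $I=(i_1,\dots,i_r)$ of positive integers with sum $n$; its descent set is $\{i_1,i_1+i_2,\dots,i_1+\cdots+i_{r-1}\}\subseteq\{1,\dots,n-1\}$, and a composition of $n$ is determined by its descent set. $\mathfrak{S}_n$ is the set of permutations $\sigma=\sigma_1\cdots\sigma_n$ of $\{1,\dots,n\}$. - A recoil of $\sigma$ is a value $i\in\{1,\dots,n-1\}$ such that $i+1$ is to the left of $i$ in $\sigma$; $\mathrm{Rec}(\sigma)$ is the composition of $n$ whose descent set is the set of recoils. - $\mathrm{GDes}(\sigma)=\{\sigma_i\mid 1\le i\le n-1,\ \sigma_i>\sigma_{i+1}\}$, and $\mathrm{GC}(\sigma)$ is the composition of $n$ whose descent set is $\{d-1\mid d\in\mathrm{GDes}(\sigma)\}$. - With the convention $\sigma_{n+1}=0$, $\mathrm{GDes}^0(\sigma)=\{\sigma_i\mid 1\le i\le n,\ \sigma_i>\sigma_{i+1}\}$ (it always contains $n$ and $\sigma_n$), and $\mathrm{GC}^0(\sigma)$ is the composition of $n$ whose descent set is $\mathrm{GDes}^0(\sigma)\setminus\{n\}$.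 - $\mathrm{tot}(\sigma)$ is the number of pairs $(i,j)$ with $i+1<j$ and $\sigma_{i+1}<\sigma_j<\sigma_i$. -}

module Defs where

open import Data.Bool.Base using (if_then_else_)
open import Data.Fin.Base using (zero; suc; toℕ; fromℕ<; punchIn)
open import Data.Fin.Permutation using (Permutation′; _⟨$⟩ʳ_; _≈_; id; flip; insert; remove; insert-remove; insert-punchIn)
open import Data.Fin.Properties using (punchIn-injective)
open import Data.List.Base using (List; []; _∷_; _++_; map; filter; foldr; length; replicate; allFin; cartesianProduct; cartesianProductWith)
open import Data.List.Membership.Propositional.Properties using (∈-allFin)
import Data.List.Membership.Setoid.Properties as Membership
open import Data.List.Properties using (≡-dec; map-∘; map-cong)
open import Data.List.Relation.Unary.All using (All; []; _∷_)
open import Data.List.Relation.Unary.AllPairs using (AllPairs; []; _∷_)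
open import Data.List.Relation.Unary.Any using (Any; here)
import Data.List.Relation.Unary.Unique.Setoid.Properties as Unique
open import Data.List.Relation.Unary.Unique.Propositional.Properties using (allFin⁺)
open import Data.Nat.Base using (ℕ; zero; suc; _+_; _∸_; _<_; z≤n; s≤s)
open import Data.Nat.ListAction using (sum)
open import Data.Nat.Properties using (_≟_; _<?_; +-suc; +-assoc; +-comm)
open import Data.List.Membership.DecPropositional _≟_ using (_∈?_)
open import Data.Product.Base using (_×_; _,_; ∃₂)
open import Level using (0ℓ)
open import Relation.Binary.Bundles using (Setoid)
open import Relation.Binary.Definitions using (DecidableEquality)
open import Relation.Binary.PropositionalEquality using (_≡_; refl; sym; trans; cong; cong₂; setoid; module ≡-Reasoning)
open import Relation.Nullary using (¬_)
open import Relation.Nullary.Decidable using (yes; no; does; ¬?; _×-dec_; map′)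

-- range a k = a , a + 1 , … , a + k ∸ 1; in particular range 1 n lists {1,…,n}.

range : ℕ → ℕ → List ℕ
range a zero    = []
range a (suc k) = a ∷ range (suc a) k

------------------------------------------------------------------------
-- Compositions

record Composition (n : ℕ) : Set where
  constructor composition
  field
    parts     : List ℕ
    .positive : All (0 <_) parts
    .total    : sum parts ≡ n

open Composition public

-- Two compositions are equal as soon as their sequences of parts are,
-- the remaining fields being irrelevant.

parts-injective : ∀ {n} {I J : Composition n} → parts I ≡ parts J → I ≡ J
parts-injective refl = refl

infix 4 _≟ᶜ_

_≟ᶜ_ : ∀ {n} → DecidableEquality (Composition n)
I ≟ᶜ J = map′ parts-injective (cong parts) (≡-dec _≟_ (parts I) (parts J))

properSums : List ℕ → List ℕ
properSums []               = []
properSums (i ∷ [])         = []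
properSums (i ∷ is@(_ ∷ _)) = i ∷ map (i +_) (properSums is)

descentSet : ∀ {n} → Composition n → List ℕ
descentSet I = properSums (parts I)

-- Reading p , p + 1 , … , p + k ∸ 1 from left to right, with c the length
-- of the part under construction: every element of D that is met ends
-- that part.

segments : List ℕ → (p c k : ℕ) → List ℕ
segments D p c zero    = c ∷ []
segments D p c (suc k) =
  if does (p ∈? D) then c ∷ segments D (suc p) 1 k
                   else segments D (suc p) (suc c) k

segments-positive : ∀ D p c k → All (0 <_) (segments D p (suc c) k)
segments-positive D p c zero = s≤s z≤n ∷ []
segments-positive D p c (suc k) with p ∈? D
... | yes _ = s≤s z≤n ∷ segments-positive D (suc p) 0 k
... | no  _ = segments-positive D (suc p) (suc c) k

segments-sum : ∀ D p c k → sum (segments D p c k) ≡ c + k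
segments-sum D p c zero = refl
segments-sum D p c (suc k) with p ∈? D
... | yes _ = cong (c +_) (segments-sum D (suc p) 1 k)
... | no  _ = trans (segments-sum D (suc p) (suc c) k) (sym (+-suc c k))

-- The composition of n with descent set D, for D ⊆ {1,…,n-1}; the order
-- and multiplicity of the entries of D are immaterial, and entries outside
-- {1,…,n-1} would be ignored.

withDescentSet : ∀ n → List ℕ → Composition n
withDescentSet zero    D = composition [] [] refl
withDescentSet (suc m) D = composition (segments D 1 1 m)
                                       (segments-positive D 1 0 m)
                                       (segments-sum D 1 1 m)

private
  segments-nonempty : ∀ D p c k → ∃₂ λ i is → segments D p c k ≡ i ∷ is
  segments-nonempty D p c zero = c , [] , refl
  segments-nonempty D p c (suc k) with p ∈? D
  ... | yes _ = c , segments D (suc p) 1 k , refl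
  ... | no  _ = segments-nonempty D (suc p) (suc c) k

  properSums-∷ : ∀ c D p c′ k → properSums (c ∷ segments D p c′ k)
                              ≡ c ∷ map (c +_) (properSums (segments D p c′ k))
  properSums-∷ c D p c′ k with segments D p c′ k | segments-nonempty D p c′ k
  ... | _ | _ , _ , refl = refl

  segments-sums : ∀ D p b c k → b + c ≡ p →
                  map (b +_) (properSums (segments D p c k)) ≡ filter (_∈? D) (range p k)
  segments-sums D p b c zero eq = refl
  segments-sums D p b c (suc k) eq with p ∈? D
  ... | no  _ = segments-sums D (suc p) b (suc c) k (trans (+-suc b c) (cong suc eq))
  ... | yes _ = begin
    map (b +_) (properSums (c ∷ S))                ≡⟨ cong (map (b +_)) (properSums-∷ c D (suc p) 1 k) ⟩
    b + c ∷ map (b +_) (map (c +_) (properSums S)) ≡⟨ cong₂ _∷_ eq (sym (map-∘ (properSums S))) ⟩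
    p ∷ map (λ x → b + (c + x)) (properSums S)     ≡⟨ cong (p ∷_) (map-cong shift (properSums S)) ⟩
    p ∷ map (p +_) (properSums S)                  ≡⟨ cong (p ∷_) (segments-sums D (suc p) p 1 k (+-comm p 1)) ⟩
    p ∷ filter (_∈? D) (range (suc p) k)           ∎
    where
    open ≡-Reasoning
    S = segments D (suc p) 1 k
    shift : ∀ x → b + (c + x) ≡ p + x
    shift x = trans (sym (+-assoc b c x)) (cong (_+ x) eq)

descentSet-withDescentSet : ∀ n D →
  descentSet (withDescentSet n D) ≡ filter (_∈? D) (range 1 (n ∸ 1))
descentSet-withDescentSet zero    D = refl
descentSet-withDescentSet (suc m) D =
  trans (sym (map-id′ (properSums (segments D 1 1 m)))) (segments-sums D 1 0 1 m refl)
  where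
  map-id′ : ∀ xs → map (0 +_) xs ≡ xs
  map-id′ []       = refl
  map-id′ (x ∷ xs) = cong (x ∷_) (map-id′ xs)

------------------------------------------------------------------------
-- Permutations

-- A list of all permutations of Fin n, each occurring once up to _≈_ (see
-- 𝔖-complete and 𝔖-unique): choose the first letter, then a permutation
-- of the remaining ones.

𝔖 : ∀ n → List (Permutation′ n)
𝔖 zero    = id ∷ []
𝔖 (suc n) = cartesianProductWith (insert zero) (allFin (suc n)) (𝔖 n)

permutationSetoid : ℕ → Setoid 0ℓ 0ℓ
permutationSetoid n = record
  { Carrier       = Permutation′ n
  ; _≈_           = _≈_
  ; isEquivalence = record
    { refl  = λ _ → refl
    ; sym   = λ p i → sym (p i)
    ; trans = λ p q i → trans (p i) (q i)
    }
  }

private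
  insert₀-cong : ∀ {n} {j j′} {π ρ : Permutation′ n} →
                 j ≡ j′ → π ≈ ρ → insert zero j π ≈ insert zero j′ ρ
  insert₀-cong refl π≈ρ zero = refl
  insert₀-cong {j = j} {π = π} {ρ} refl π≈ρ (suc i) =
    trans (insert-punchIn zero j π i)
      (trans (cong (punchIn j) (π≈ρ i)) (sym (insert-punchIn zero j ρ i)))

  insert₀-injective : ∀ {n} {j j′} {π ρ : Permutation′ n} →
                      insert zero j π ≈ insert zero j′ ρ → j ≡ j′ × π ≈ ρ
  insert₀-injective {j = j} {j′} {π} {ρ} p with p zero
  ... | refl = refl , λ i → punchIn-injective j _ _
    (trans (sym (insert-punchIn zero j π i)) (trans (p (suc i)) (insert-punchIn zero j ρ i)))

𝔖-complete : ∀ {n} (π : Permutation′ n) → Any (π ≈_) (𝔖 n)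
𝔖-complete {zero}  π = here λ ()
𝔖-complete {suc n} π =
  Membership.∈-resp-≈ (permutationSetoid (suc n))
    {x = insert zero (π ⟨$⟩ʳ zero) (remove zero π)} {y = π} (insert-remove zero π)
    (Membership.∈-cartesianProductWith⁺ (setoid _) (permutationSetoid n) (permutationSetoid (suc n))
      (λ {j} {j′} {ρ} {ρ′} → insert₀-cong {j = j} {j′} {ρ} {ρ′})
      (∈-allFin (π ⟨$⟩ʳ zero)) (𝔖-complete (remove zero π)))

𝔖-unique : ∀ n → AllPairs (λ π ρ → ¬ π ≈ ρ) (𝔖 n)
𝔖-unique zero    = [] ∷ []
𝔖-unique (suc n) =
  Unique.cartesianProductWith⁺ (setoid _) (permutationSetoid n) (permutationSetoid (suc n))
    (insert zero) (λ {j} {j′} {π} {ρ} → insert₀-injective {j = j} {j′} {π} {ρ})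
    (allFin⁺ (suc n)) (𝔖-unique n)

-- σ at p is the letter σ_p ∈ {1,…,n} for p ∈ {1,…,n}, and 0 for any other p;
-- hence the convention σ_{n+1} = 0 is built in.  For a value v, flip σ at v
-- is the position of v in the word σ.

infix 8 _at_

_at_ : ∀ {n} → Permutation′ n → ℕ → ℕ
_at_     σ zero    = 0
_at_ {n} σ (suc p) with p <? n
... | yes p<n = suc (toℕ (σ ⟨$⟩ʳ fromℕ< p<n))
... | no  _   = 0

module _ {n : ℕ} (σ : Permutation′ n) where

  recoils : List ℕ
  recoils = filter (λ i → flip σ at (i + 1) <? flip σ at i) (range 1 (n ∸ 1))

  Rec : Composition n
  Rec = withDescentSet n recoils

  GDes : List ℕ
  GDes = map (σ at_) (filter (λ i → σ at (i + 1) <? σ at i) (range 1 (n ∸ 1)))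

  GC : Composition n
  GC = withDescentSet n (map (_∸ 1) GDes)

  GDes⁰ : List ℕ
  GDes⁰ = map (σ at_) (filter (λ i → σ at (i + 1) <? σ at i) (range 1 n))

  GC⁰ : Composition n
  GC⁰ = withDescentSet n (filter (λ d → ¬? (d ≟ n)) GDes⁰)

  tot : ℕ
  tot = length (filter (λ (i , j) → (i + 1 <? j) ×-dec
                                    (σ at (i + 1) <? σ at j) ×-dec
                                    (σ at j <? σ at i))
                       (cartesianProduct (range 1 n) (range 1 n)))

------------------------------------------------------------------------
-- Polynomials in q with natural number coefficients

-- Coefficient lists, constant term first, compared by _≈ₚ_ since trailing
-- zeros carry no information.

ℕ[q] : Set
ℕ[q] = List ℕ

coeff : ℕ[q] → ℕ → ℕ
coeff []      _       = 0
coeff (a ∷ f) zero    = a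
coeff (a ∷ f) (suc k) = coeff f k

infix 4 _≈ₚ_

_≈ₚ_ : ℕ[q] → ℕ[q] → Set
f ≈ₚ g = ∀ k → coeff f k ≡ coeff g k

infixl 6 _+ₚ_

_+ₚ_ : ℕ[q] → ℕ[q] → ℕ[q]
[]      +ₚ g       = g
(a ∷ f) +ₚ []      = a ∷ f
(a ∷ f) +ₚ (b ∷ g) = a + b ∷ f +ₚ g

infix 9 q^_

q^_ : ℕ → ℕ[q]
q^ k = replicate k 0 ++ 1 ∷ []

∑ₚ : ∀ {A : Set} → List A → (A → ℕ[q]) → ℕ[q]
∑ₚ xs f = foldr _+ₚ_ [] (map f xs)

{-# OPTIONS --safe #-}

-- Attach to each letter v of a word its code: the number of descents a b with
-- a > v > b lying to the left of v, whether the left neighbour of v is larger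
-- than v, and whether the right neighbour is smaller.  The first numbers add
-- up to tot, the first two components determine the recoils, and the third
-- one the descent tops.  Replacing the letters ≥ v of a word by a bar and
-- merging adjacent bars leaves a pattern; v is put back by splitting one bar
-- as prescribed by its code, so a word can be rebuilt from its codes, value by
-- value.  Passing the third component of v - 1 on to v (and declaring that 1
-- is not a descent top) turns the codes of σ into those of a word σ′ ending
-- in n + 1: the number of bars of the new pattern exceeds that of the old one
-- by the bit that is still to be passed on, hence there is always a bar to
-- split and the final bar survives.  The map σ ↦ σ′ is injective and carries
-- (Rec , GC⁰ , tot) to (Rec , GC , tot).

module Submission where

open import Defs
open import Data.Bool.Base using (Bool; true; false; not; if_then_else_)
import Data.Bool.Properties as Bool
open import Data.Fin.Base using (Fin; toℕ; fromℕ<; cast)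
open import Data.Fin.Permutation using (Permutation′; _⟨$⟩ʳ_; _≈_; flip; inverseˡ; cast-id; _∘ₚ_)
open import Data.Fin.Properties using (toℕ<n; toℕ-fromℕ<; fromℕ<-toℕ; toℕ-cast; cast-involutive; toℕ-injective)
open import Data.List.Base using (List; []; _∷_; _++_; filter; map; length; lookup; cartesianProduct)
open import Data.List.Membership.Propositional using (_∈_; _∉_)
open import Data.List.Membership.Propositional.Properties using (∈-map⁺; ∈-map⁻; ∈-filter⁺; ∈-filter⁻; ∈-++⁺ˡ; ∈-++⁺ʳ; ∈-++⁻; ∈-∃++)
open import Data.List.Properties using (filter-accept; filter-reject; filter-none; filter-++; length-++; length-map; map-∘; map-cong; map-cong-local; map-++; ++-assoc; ++-identityʳ; ∷-injectiveˡ; ∷-injectiveʳ)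
open import Data.List.Relation.Binary.Permutation.Propositional using (_↭_; prep; swap; ↭-refl; ↭-sym; ↭-trans; ↭⇒↭ₛ)
open import Data.List.Relation.Binary.Permutation.Propositional.Properties using (∈-resp-↭; ¬x∷xs↭[]; ∷↭∷ʳ; ↭-length; shift; filter-↭; map⁺)
open import Data.List.Relation.Unary.All as All using (All; []; _∷_)
open import Data.List.Relation.Unary.AllPairs as AllPairs using ([]; _∷_)
import Data.List.Relation.Unary.AllPairs.Properties as AllPairs
open import Data.List.Relation.Unary.Any as Any using (here; there)
import Data.List.Relation.Unary.Any.Properties as Any
open import Data.List.Relation.Unary.Unique.Propositional using (Unique)
open import Data.Nat.Base using (ℕ; zero; suc; pred; _+_; _∸_; _≤_; _<_; z≤n; s≤s)
open import Data.Nat.ListAction using (sum)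
open import Data.Nat.ListAction.Properties using (sum-↭)
open import Data.Nat.Properties
open import Algebra.Properties.CommutativeSemigroup +-commutativeSemigroup using (interchange)
open import Data.List.Membership.DecPropositional _≟_ using (_∈?_)
open import Data.Product.Base using (_×_; _,_; proj₁; proj₂; ∃)
open import Data.Sum.Base using (inj₁; inj₂)
open import Function.Base using (_∘_)
open import Function.Bundles using (_⇔_; mk⇔; Equivalence)
open import Function.Properties.Equivalence using (⇔-setoid)
open import Level using (0ℓ)
open import Relation.Binary.Bundles using (Setoid)
open import Relation.Binary.Definitions using (tri<; tri≈; tri>)
open import Relation.Binary.PropositionalEquality using (_≡_; _≢_; ≢-sym; refl; sym; trans; cong; cong₂; subst; subst₂; setoid; module ≡-Reasoning)
open import Data.List.Relation.Binary.Permutation.Setoid (setoid ℕ) using (onIndices)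
open import Data.List.Relation.Binary.Permutation.Setoid.Properties (setoid ℕ) using (Unique-resp-↭; onIndices-lookup)
open import Relation.Nullary.Decidable using (Dec; _×-dec_; does; yes; no; ¬?; dec-true; dec-false; does-⇔)
open import Relation.Nullary.Negation using (¬_; contradiction)
open import Relation.Unary using (Decidable)

open Setoid (⇔-setoid 0ℓ) using () renaming (sym to ⇔-sym; trans to ⇔-trans)

-- Codes of the letters of a word

𝟙 : Bool → ℕ
𝟙 true  = 1
𝟙 false = 0

-- crossings counts the pairs a b as in tot with v in between, fall says that
-- v is preceded by a larger letter, top that it is followed by a smaller one.

record Code : Set where
  constructor ⟨_,_,_⟩
  field
    crossings : ℕ
    fall      : Bool
    top       : Bool

open Code

addCrossing : Bool → Code → Code
addCrossing b c = record c { crossings = 𝟙 b + crossings c }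

startsBelow : ℕ → List ℕ → Bool
startsBelow v []      = true
startsBelow v (x ∷ _) = does (x <? v)

-- The flag of code (and of squash below) tells whether the letter just before
-- the list is larger than v (respectively, is a bar).  A word is followed by
-- an implicit 0.

code : ℕ → Bool → List ℕ → Code
code v b []       = ⟨ 0 , b , false ⟩
code v b (x ∷ xs) with <-cmp x v
... | tri< _ _ _ = addCrossing b (code v false xs)
... | tri≈ _ _ _ = ⟨ 0 , b , startsBelow v xs ⟩
... | tri> _ _ _ = code v true xs

code-< : ∀ {v x} b xs → x < v → code v b (x ∷ xs) ≡ addCrossing b (code v false xs)
code-< {v} {x} b xs x<v with <-cmp x v
... | tri< _ _ _   = refl
... | tri≈ x≮v _ _ = contradiction x<v x≮v
... | tri> x≮v _ _ = contradiction x<v x≮v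

code-≡ : ∀ v b xs → code v b (v ∷ xs) ≡ ⟨ 0 , b , startsBelow v xs ⟩
code-≡ v b xs with <-cmp v v
... | tri< _ v≢v _ = contradiction refl v≢v
... | tri≈ _ _ _   = refl
... | tri> _ v≢v _ = contradiction refl v≢v

code-> : ∀ {v x} b xs → v < x → code v b (x ∷ xs) ≡ code v true xs
code-> {v} {x} b xs v<x with <-cmp x v
... | tri< _ _ x≯v = contradiction v<x x≯v
... | tri≈ _ _ x≯v = contradiction v<x x≯v
... | tri> _ _ _   = refl

-- Patterns with bars: splitting and merging

-- A bar is encoded by a letter N larger than all others, so that code applies
-- to patterns as well as to words.

module _ (N : ℕ) where

  barIf : Bool → List ℕ → List ℕ
  barIf b W = if b then N ∷ W else W

  -- Split the bar number crossings c, counted from 0.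

  expand : ℕ → Code → List ℕ → List ℕ
  expand k c [] = []
  expand k ⟨ p , l , t ⟩ (x ∷ W) with x ≟ N | p
  ... | yes _ | zero  = barIf l (k ∷ barIf (not t) W)
  ... | yes _ | suc p = N ∷ expand k ⟨ p , l , t ⟩ W
  ... | no  _ | p     = x ∷ expand k ⟨ p , l , t ⟩ W

  squash : ℕ → Bool → List ℕ → List ℕ
  squash k b [] = []
  squash k b (x ∷ xs) with x <? k
  ... | yes _ = x ∷ squash k false xs
  ... | no  _ = barIf (not b) (squash k true xs)

  bars : List ℕ → ℕ
  bars []      = 0
  bars (x ∷ W) = 𝟙 (does (x ≟ N)) + bars W

  letters : List ℕ → List ℕ
  letters = filter (¬? ∘ (_≟ N))

  -- Rules out adjacent bars, so that a bar about to be split has on its right a letter below `k` or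
  -- the end, and `top` can be prescribed at will.
  data Squashed (k : ℕ) : Bool → List ℕ → Set where
    []     : ∀ {b} → Squashed k b []
    letter : ∀ {b x W} → x < k → Squashed k false W → Squashed k b (x ∷ W)
    bar    : ∀ {W} → Squashed k true W → Squashed k false (N ∷ W)

  data EndsInBar : List ℕ → Set where
    last : EndsInBar (N ∷ [])
    _∷_  : ∀ x {W} → EndsInBar W → EndsInBar (x ∷ W)

  expand-zero : ∀ k l t W → expand k ⟨ 0 , l , t ⟩ (N ∷ W) ≡ barIf l (k ∷ barIf (not t) W)
  expand-zero k l t W with N ≟ N
  ... | yes _  = refl
  ... | no N≢N = contradiction refl N≢N

  expand-suc : ∀ k p l t W → expand k ⟨ suc p , l , t ⟩ (N ∷ W) ≡ N ∷ expand k ⟨ p , l , t ⟩ W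
  expand-suc k p l t W with N ≟ N
  ... | yes _  = refl
  ... | no N≢N = contradiction refl N≢N

  expand-letter : ∀ k c {x} W → x ≢ N → expand k c (x ∷ W) ≡ x ∷ expand k c W
  expand-letter k c {x} W x≢N with x ≟ N
  ... | yes x≡N = contradiction x≡N x≢N
  ... | no  _   = refl

  bars-bar : ∀ W → bars (N ∷ W) ≡ suc (bars W)
  bars-bar W rewrite dec-true (N ≟ N) refl = refl

  bars-letter : ∀ {x} W → x ≢ N → bars (x ∷ W) ≡ bars W
  bars-letter {x} W x≢N rewrite dec-false (x ≟ N) x≢N = refl

  squash-< : ∀ {k x} b xs → x < k → squash k b (x ∷ xs) ≡ x ∷ squash k false xs
  squash-< {k} {x} b xs x<k with x <? k
  ... | yes _  = refl
  ... | no x≮k = contradiction x<k x≮k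

  squash-≥ : ∀ {k x} b xs → k ≤ x → squash k b (x ∷ xs) ≡ barIf (not b) (squash k true xs)
  squash-≥ {k} {x} b xs k≤x with x <? k
  ... | yes x<k = contradiction k≤x (<⇒≱ x<k)
  ... | no _    = refl

  Squashed-weaken : ∀ {k b W} → Squashed k b W → Squashed (suc k) b W
  Squashed-weaken []             = []
  Squashed-weaken (letter x<k W) = letter (m<n⇒m<1+n x<k) (Squashed-weaken W)
  Squashed-weaken (bar W)        = bar (Squashed-weaken W)

  Squashed-unflag : ∀ {k W} → Squashed k true W → Squashed k false W
  Squashed-unflag []             = []
  Squashed-unflag (letter x<k W) = letter x<k W

  Squashed-barIf : ∀ {k W} b → Squashed k true W → Squashed k false (barIf b W)
  Squashed-barIf true  W = bar W
  Squashed-barIf false W = Squashed-unflag W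

  expand-Squashed : ∀ {k b W} c → k < N → Squashed k b W → Squashed (suc k) b (expand k c W)
  expand-Squashed c k<N [] = []
  expand-Squashed {k} c k<N (letter {x = x} {W} x<k sW)
    rewrite expand-letter k c W (<⇒≢ (<-trans x<k k<N)) =
    letter (m<n⇒m<1+n x<k) (expand-Squashed c k<N sW)
  expand-Squashed {k} ⟨ zero , l , t ⟩ k<N (bar {W} sW)
    rewrite expand-zero k l t W =
    Squashed-barIf l (letter (n<1+n k) (Squashed-barIf (not t) (Squashed-weaken sW)))
  expand-Squashed {k} ⟨ suc p , l , t ⟩ k<N (bar {W} sW)
    rewrite expand-suc k p l t W = bar (expand-Squashed ⟨ p , l , t ⟩ k<N sW)

  -- What follows a bar is a smaller letter or the implicit 0, so `k` is a descent top exactly when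
  -- no bar is kept on its right.
  startsBelow-barIf : ∀ {k W} t → k < N → Squashed k true W → startsBelow k (barIf (not t) W) ≡ t
  startsBelow-barIf {k} false k<N _ = dec-false (N <? k) (<⇒≯ k<N)
  startsBelow-barIf true  k<N [] = refl
  startsBelow-barIf {k} true  k<N (letter {x = x} x<k _) = dec-true (x <? k) x<k

  -- As bars are never adjacent, each bar before the split one forms a descent with the letter after
  -- it, and this descent crosses `k`. The summand `𝟙 b` is the bar just in front of the list.
  code-expand-self : ∀ {k b W} p l t → k < N → Squashed k b W → p < bars W →
                     code k b (expand k ⟨ p , l , t ⟩ W) ≡ ⟨ 𝟙 b + p , l , t ⟩
  code-expand-self {k} {b} p l t k<N (letter {x = x} {W} x<k sW) p<
    rewrite bars-letter W (<⇒≢ (<-trans x<k k<N))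
          | expand-letter k ⟨ p , l , t ⟩ W (<⇒≢ (<-trans x<k k<N))
          | code-< b (expand k ⟨ p , l , t ⟩ W) x<k
          | code-expand-self p l t k<N sW p< = refl
  code-expand-self {k} zero true t k<N (bar {W} sW) p<
    rewrite expand-zero k true t W
          | code-> false (k ∷ barIf (not t) W) k<N
          | code-≡ k true (barIf (not t) W)
          | startsBelow-barIf t k<N sW = refl
  code-expand-self {k} zero false t k<N (bar {W} sW) p<
    rewrite expand-zero k false t W
          | code-≡ k false (barIf (not t) W)
          | startsBelow-barIf t k<N sW = refl
  code-expand-self {k} (suc p) l t k<N (bar {W} sW) p<
    rewrite expand-suc k p l t W
          | bars-bar W
          | code-> false (expand k ⟨ p , l , t ⟩ W) k<N
          = code-expand-self p l t k<N sW (≤-pred p<)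

  startsBelow-expand : ∀ {j k} c W → j ≤ k → k < N → startsBelow j (expand k c W) ≡ startsBelow j W
  startsBelow-expand c [] j≤k k<N = refl
  startsBelow-expand {j} {k} ⟨ p , l , t ⟩ (x ∷ W) j≤k k<N with x ≟ N | p | l
  ... | yes refl | zero  | true  = refl
  ... | yes refl | zero  | false =
    trans (dec-false (k <? j) (≤⇒≯ j≤k)) (sym (dec-false (N <? j) (<⇒≯ (≤-<-trans j≤k k<N))))
  ... | yes refl | suc _ | _     = refl
  ... | no _     | _     | _     = refl

  -- Seen from a smaller value `j`, the bar, `k` and the bars kept around `k` are all just larger
  -- letters: a nonempty run of such letters is replaced by another one, which alters neither
  -- crossings nor neighbours of `j`.
  code-expand : ∀ {j k} b c W → j < k → k < N → code j b (expand k c W) ≡ code j b W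
  code-expand b c [] j<k k<N = refl
  code-expand {j} {k} b ⟨ p , l , t ⟩ (x ∷ W) j<k k<N with x ≟ N | p
  ... | yes refl | suc p
    rewrite code-> b (expand k ⟨ p , l , t ⟩ W) (<-trans j<k k<N)
          | code-> b W (<-trans j<k k<N) = code-expand true ⟨ p , l , t ⟩ W j<k k<N
  ... | yes refl | zero = trans (skip-l b l) (trans (code-> _ _ j<k) (trans (skip-t (not t)) (sym (code-> b W j<N))))
    where
    j<N = <-trans j<k k<N
    skip-l : ∀ b l → code j b (barIf l (k ∷ barIf (not t) W)) ≡ code j (if l then true else b) (k ∷ barIf (not t) W)
    skip-l b true  = code-> b (k ∷ barIf (not t) W) j<N
    skip-l b false = refl
    skip-t : ∀ t → code j true (barIf t W) ≡ code j true W
    skip-t true  = code-> true W j<N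
    skip-t false = refl
  ... | no _ | p with <-cmp x j
  ... | tri< _ _ _ = cong (addCrossing b) (code-expand false ⟨ p , l , t ⟩ W j<k k<N)
  ... | tri≈ _ _ _ = cong ⟨ 0 , b ,_⟩ (startsBelow-expand ⟨ p , l , t ⟩ W (<⇒≤ j<k) k<N)
  ... | tri> _ _ _ = code-expand true ⟨ p , l , t ⟩ W j<k k<N

  bars-barIf : ∀ b W → bars (barIf b W) ≡ 𝟙 b + bars W
  bars-barIf true  W = bars-bar W
  bars-barIf false W = refl

  -- One bar is used up and up to two are put back; the `suc` on the left stands for the former and
  -- avoids subtraction.
  bars-expand : ∀ {k} p l t W → k < N → p < bars W →
                suc (bars (expand k ⟨ p , l , t ⟩ W)) ≡ 𝟙 l + 𝟙 (not t) + bars W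
  bars-expand {k} p l t (x ∷ W) k<N p< with x ≟ N | p
  ... | yes refl | zero
    rewrite bars-bar W | bars-barIf l (k ∷ barIf (not t) W)
          | bars-letter (barIf (not t) W) (<⇒≢ k<N)
          | bars-barIf (not t) W
          | +-assoc (𝟙 l) (𝟙 (not t)) (suc (bars W))
          | +-suc (𝟙 (not t)) (bars W)
          | +-suc (𝟙 l) (𝟙 (not t) + bars W) = refl
  ... | yes refl | suc p
    rewrite bars-bar W | bars-bar (expand k ⟨ p , l , t ⟩ W)
          | +-suc (𝟙 l + 𝟙 (not t)) (bars W) = cong suc (bars-expand p l t W k<N (≤-pred p<))
  ... | no x≢N | p rewrite bars-letter W x≢N | bars-letter (expand k ⟨ p , l , t ⟩ W) x≢N = bars-expand p l t W k<N p<

  letters-bar : ∀ W → letters (N ∷ W) ≡ letters W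
  letters-bar W = filter-reject (¬? ∘ (_≟ N)) (λ N≢N → N≢N refl)

  letters-barIf : ∀ b W → letters (barIf b W) ≡ letters W
  letters-barIf true  W = letters-bar W
  letters-barIf false W = refl

  letters-letter : ∀ {x} W → x ≢ N → letters (x ∷ W) ≡ x ∷ letters W
  letters-letter W = filter-accept (¬? ∘ (_≟ N))

  letters-expand : ∀ {k} p l t W → k < N → p < bars W →
                   letters (expand k ⟨ p , l , t ⟩ W) ↭ k ∷ letters W
  letters-expand {k} p l t (x ∷ W) k<N p< with x ≟ N | p
  ... | yes refl | zero
    rewrite letters-barIf l (k ∷ barIf (not t) W)
          | letters-letter (barIf (not t) W) (<⇒≢ k<N)
          | letters-barIf (not t) W | letters-bar W = ↭-refl
  ... | yes refl | suc p
    rewrite bars-bar W | letters-bar W | letters-bar (expand k ⟨ p , l , t ⟩ W) = letters-expand p l t W k<N (≤-pred p<)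
  ... | no x≢N | p
    rewrite bars-letter W x≢N | letters-letter W x≢N | letters-letter (expand k ⟨ p , l , t ⟩ W) x≢N =
    ↭-trans (prep x (letters-expand p l t W k<N p<)) (swap x k ↭-refl)

  0<bars : ∀ {W} → EndsInBar W → 0 < bars W
  0<bars last rewrite bars-bar [] = s≤s z≤n
  0<bars (_∷_ x {W} e) = ≤-trans (0<bars e) (m≤n+m (bars W) _)

  EndsInBar-barIf : ∀ b {W} → EndsInBar W → EndsInBar (barIf b W)
  EndsInBar-barIf true  e = N ∷ e
  EndsInBar-barIf false e = e

  -- The final bar can disappear only if it is the one being split and `t` is `true`. Then `p + 1`
  -- is the number of bars, against the hypothesis.
  expand-EndsInBar : ∀ {k} p l t {W} → p + 𝟙 t < bars W → EndsInBar W →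
                     EndsInBar (expand k ⟨ p , l , t ⟩ W)
  expand-EndsInBar {k} zero l false {W = _ ∷ []} p< last
    rewrite expand-zero k l false [] = EndsInBar-barIf l (k ∷ last)
  expand-EndsInBar {k} zero l true {W = _ ∷ []} p< last
    rewrite bars-bar [] with s≤s () ← p<
  expand-EndsInBar {k} (suc p) l t {W = _ ∷ []} p< last
    rewrite bars-bar [] with s≤s () ← p<
  expand-EndsInBar {k} p l t {W = _ ∷ W} p< (x ∷ e) with x ≟ N | p
  ... | yes refl | zero  = EndsInBar-barIf l (k ∷ EndsInBar-barIf (not t) e)
  ... | yes refl | suc p rewrite bars-bar W = N ∷ expand-EndsInBar p l t (≤-pred p<) e
  ... | no x≢N   | p     rewrite bars-letter W x≢N = x ∷ expand-EndsInBar p l t p< e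

  split-last-bar : ∀ {W} → EndsInBar W → bars W ≡ 1 → W ≡ letters W ++ N ∷ []
  split-last-bar last _ rewrite letters-bar [] = refl
  split-last-bar (_∷_ x {W} e) eq with x ≟ N
  ... | no x≢N rewrite bars-letter W x≢N | letters-letter W x≢N = cong (x ∷_) (split-last-bar e eq)
  ... | yes refl rewrite bars-bar W = contradiction (suc-injective eq) (≢-sym (<⇒≢ (0<bars e)))

  squash-absent : ∀ {k} b w → k ∉ w → squash (suc k) b w ≡ squash k b w
  squash-absent b [] k∉ = refl
  squash-absent {k} b (x ∷ w) k∉ with <-cmp x k
  ... | tri< x<k _ _ rewrite squash-< b w x<k | squash-< b w (m<n⇒m<1+n x<k) =
    cong (x ∷_) (squash-absent false w (k∉ ∘ there))
  ... | tri≈ _ refl _ = contradiction (here refl) k∉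
  ... | tri> _ _ x>k rewrite squash-≥ b w x>k | squash-≥ b w (<⇒≤ x>k) =
    cong (barIf (not b)) (squash-absent true w (k∉ ∘ there))

  -- Describes what happens to the right of `k` when it turns from a part of a bar into a letter:
  -- the larger letters directly after it, if there are any, become a bar of their own.
  squash-after : ∀ {k} w → k ∉ w → squash (suc k) false w ≡ barIf (not (startsBelow k w)) (squash k true w)
  squash-after [] k∉ = refl
  squash-after {k} (x ∷ w) k∉ with <-cmp x k
  ... | tri< x<k _ _
    rewrite squash-< false w (m<n⇒m<1+n x<k) | squash-< true w x<k | dec-true (x <? k) x<k =
    cong (x ∷_) (squash-absent false w (k∉ ∘ there))
  ... | tri≈ _ refl _ = contradiction (here refl) k∉
  ... | tri> x≮k _ x>k
    rewrite squash-≥ false w x>k | squash-≥ true w (<⇒≤ x>k) | dec-false (x <? k) x≮k =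
    cong (N ∷_) (squash-absent true w (k∉ ∘ there))

  barIf-not : ∀ b W → barIf b (barIf (not b) W) ≡ N ∷ W
  barIf-not true  W = refl
  barIf-not false W = refl

  -- Raising the threshold past `k` splits the bar that contains `k`, and the code of `k` records
  -- which bar this is and on which sides a bar remains. The `barIf b` in front restores the bar
  -- preceding the list, to which `k` may itself belong.
  expand-squash : ∀ {k} b w → k < N → k ∈ w → Unique w →
                  expand k (code k b w) (barIf b (squash k b w)) ≡ barIf b (squash (suc k) b w)
  expand-squash {k} b (x ∷ w) k<N k∈ (x∉ ∷ u) with <-cmp x k
  ... | tri≈ _ refl _
    rewrite squash-≥ b w (≤-refl {k}) | barIf-not b (squash k true w)
          | squash-< b w (n<1+n k) | squash-after w (λ k∈w → All.lookup x∉ k∈w refl) =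
    expand-zero k b (startsBelow k w) (squash k true w)
  ... | tri> _ x≢k x>k
    rewrite squash-≥ b w (<⇒≤ x>k) | squash-≥ b w x>k
          | barIf-not b (squash k true w) | barIf-not b (squash (suc k) true w) =
    expand-squash true w k<N (Any.tail (x≢k ∘ sym) k∈) u
  ... | tri< x<k x≢k _
    rewrite squash-< b w x<k | squash-< b w (m<n⇒m<1+n x<k) = below b
    where
    c = code k false w
    tail : expand k c (x ∷ squash k false w) ≡ x ∷ squash (suc k) false w
    tail = trans (expand-letter k c (squash k false w) (<⇒≢ (<-trans x<k k<N)))
                 (cong (x ∷_) (expand-squash false w k<N (Any.tail (x≢k ∘ sym) k∈) u))
    below : ∀ b → expand k (addCrossing b c) (barIf b (x ∷ squash k false w)) ≡ barIf b (x ∷ squash (suc k) false w)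
    below false = tail
    below true  = trans (expand-suc k (crossings c) (fall c) (top c) (x ∷ squash k false w)) (cong (N ∷_) tail)

  -- Besides the bars that end in a descent crossing `k` there is the bar containing `k`.
  crossings<bars : ∀ {k} b w → k < N → k ∈ w →
                   crossings (code k b w) < bars (barIf b (squash k b w))
  crossings<bars {k} b (x ∷ w) k<N k∈ with <-cmp x k
  ... | tri≈ _ refl _
    rewrite squash-≥ b w (≤-refl {k}) | barIf-not b (squash k true w) | bars-bar (squash k true w) = s≤s z≤n
  ... | tri> _ x≢k x>k
    rewrite squash-≥ b w (<⇒≤ x>k) | barIf-not b (squash k true w) =
    crossings<bars true w k<N (Any.tail (x≢k ∘ sym) k∈)
  ... | tri< x<k x≢k _
    rewrite squash-< b w x<k | bars-barIf b (x ∷ squash k false w)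
          | bars-letter (squash k false w) (<⇒≢ (<-trans x<k k<N)) =
    +-monoʳ-< (𝟙 b) (crossings<bars false w k<N (Any.tail (x≢k ∘ sym) k∈))

-- Intervals of integers and their rearrangements

∈-range⁻ : ∀ {v} a k → v ∈ range a k → a ≤ v × v < a + k
∈-range⁻ a (suc k) (here refl) = ≤-refl , m<m+n a (s≤s z≤n)
∈-range⁻ {v} a (suc k) (there v∈) with l , u ← ∈-range⁻ (suc a) k v∈ =
  <⇒≤ l , subst (v <_) (sym (+-suc a k)) u

∈-range⁺ : ∀ {v} a k → a ≤ v → v < a + k → v ∈ range a k
∈-range⁺ {v} a zero a≤v v< = contradiction (subst (v <_) (+-identityʳ a) v<) (≤⇒≯ a≤v)
∈-range⁺ {v} a (suc k) a≤v v< with a ≟ v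
... | yes refl = here refl
... | no a≢v   = there (∈-range⁺ (suc a) k (≤∧≢⇒< a≤v a≢v) (subst (v <_) (+-suc a k) v<))

range-unique : ∀ a k → Unique (range a k)
range-unique a zero    = []
range-unique a (suc k) =
  All.tabulate (λ v∈ → <⇒≢ (proj₁ (∈-range⁻ (suc a) k v∈))) ∷ range-unique (suc a) k

range-∷ʳ : ∀ a k → range a (suc k) ≡ range a k ++ a + k ∷ []
range-∷ʳ a zero    = cong (_∷ []) (sym (+-identityʳ a))
range-∷ʳ a (suc k) rewrite +-suc a k = cong (a ∷_) (range-∷ʳ (suc a) k)

module _ {n w} (w↭ : w ↭ range 1 n) where

  word-unique : Unique w
  word-unique = Unique-resp-↭ (↭⇒↭ₛ (↭-sym w↭)) (range-unique 1 n)

  word-∈ : ∀ {v} → 0 < v → v ≤ n → v ∈ w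
  word-∈ 0<v v≤n = ∈-resp-↭ (↭-sym w↭) (∈-range⁺ 1 n 0<v (s≤s v≤n))

  word-positive : All (0 <_) w
  word-positive = All.tabulate (proj₁ ∘ ∈-range⁻ 1 n ∘ ∈-resp-↭ w↭)

  word-bounded : All (_< suc n) w
  word-bounded = All.tabulate (proj₂ ∘ ∈-range⁻ 1 n ∘ ∈-resp-↭ w↭)

-- Reconstruction of a word from its codes

top-code-zero : ∀ b {w} → All (0 <_) w → top (code 0 b w) ≡ false
top-code-zero b [] = refl
top-code-zero b {x ∷ w} (0<x ∷ 0<w) rewrite code-> b w 0<x = top-code-zero true 0<w

squash-bounded : ∀ N {k w} b → All (_< k) w → squash N k b w ≡ w
squash-bounded N b [] = refl
squash-bounded N {w = x ∷ w} b (x<k ∷ w<k) rewrite squash-< N b w x<k = cong (x ∷_) (squash-bounded N false w<k)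

squash-one-true : ∀ N {w} → All (0 <_) w → squash N 1 true w ≡ []
squash-one-true N [] = refl
squash-one-true N {x ∷ w} (0<x ∷ 0<w) rewrite squash-≥ N true w 0<x = squash-one-true N 0<w

squash-one : ∀ {n w} N → 0 < n → w ↭ range 1 n → squash N 1 false w ≡ N ∷ []
squash-one {suc _} {[]} N _ w↭ = contradiction (↭-sym w↭) ¬x∷xs↭[]
squash-one {suc _} {x ∷ w} N _ w↭ with 0<x ∷ 0<w ← word-positive w↭
  rewrite squash-≥ N false w 0<x = cong (N ∷_) (squash-one-true N 0<w)

bars-bounded : ∀ {N w} → All (_< N) w → bars N w ≡ 0
bars-bounded [] = refl
bars-bounded {N} {x ∷ w} (x<N ∷ w<N) rewrite bars-letter N w (<⇒≢ x<N) = bars-bounded w<N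

-- At threshold 1 both words are a single bar, at threshold `n + 1` they are themselves. In between,
-- `expand-squash` computes each pattern from the previous one and one code.
code-injective : ∀ {n w w′} → 0 < n → w ↭ range 1 n → w′ ↭ range 1 n →
                 (∀ {v} → 0 < v → v ≤ n → code v false w ≡ code v false w′) → w ≡ w′
code-injective {n} {w} {w′} 0<n w↭ w′↭ eq = begin
  w                         ≡⟨ squash-bounded N false (word-bounded w↭) ⟨
  squash N (suc n) false w  ≡⟨ squashes n ≤-refl ⟩
  squash N (suc n) false w′ ≡⟨ squash-bounded N false (word-bounded w′↭) ⟩
  w′                        ∎
  where
  open ≡-Reasoning
  N = suc n
  squashes : ∀ k → k ≤ n → squash N (suc k) false w ≡ squash N (suc k) false w′
  squashes zero    _   = trans (squash-one N 0<n w↭) (sym (squash-one N 0<n w′↭))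
  squashes (suc k) k<n = begin
    squash N (2 + k) false w
      ≡⟨ expand-squash N false w (s≤s k<n) (word-∈ w↭ (s≤s z≤n) k<n) (word-unique w↭) ⟨
    expand N (suc k) (code (suc k) false w) (squash N (suc k) false w)
      ≡⟨ cong₂ (expand N (suc k)) (eq (s≤s z≤n) k<n) (squashes k (<⇒≤ k<n)) ⟩
    expand N (suc k) (code (suc k) false w′) (squash N (suc k) false w′)
      ≡⟨ expand-squash N false w′ (s≤s k<n) (word-∈ w′↭ (s≤s z≤n) k<n) (word-unique w′↭) ⟩
    squash N (2 + k) false w′ ∎

-- Construction of the word with shifted tops

-- The value 0 does not occur, so its junk code makes 1 not a top.

shiftTops : (ℕ → Code) → ℕ → Code
shiftTops c v = record (c v) { top = top (c (pred v)) }

build : ℕ → (ℕ → Code) → ℕ → List ℕ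
build N c zero    = N ∷ []
build N c (suc k) = expand N (suc k) (shiftTops c (suc k)) (build N c k)

module _ {n w} (0<n : 0 < n) (w↭ : w ↭ range 1 n) where

  private
    N = suc n
    c : ℕ → Code
    c v = code v false w
    S : ℕ → List ℕ
    S k = squash N (suc k) false w

  -- The invariant of the construction. `S k` is the pattern of `w` itself at the same stage; by
  -- `count` the new pattern is ahead of it by the bit that `k + 1` will receive.
  record Built (k : ℕ) (G : List ℕ) : Set where
    field
      squashed : Squashed N (suc k) false G
      ends     : EndsInBar N G
      count    : bars N G ≡ bars N (S k) + 𝟙 (top (c k))
      letters↭ : letters N G ↭ range 1 k
      codes    : ∀ {v} → 0 < v → v ≤ k → code v false G ≡ shiftTops c v

  open Built

  built : ∀ k → k ≤ n → Built k (build N c k)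
  built zero k≤n = record
    { squashed = bar []
    ; ends     = last
    -- Both patterns are a single bar, and the bit of 0 is `false`.
    ; count    = sym (trans (cong₂ (λ W t → bars N W + 𝟙 t) (squash-one N 0<n w↭)
                              (top-code-zero false (word-positive w↭)))
                            (+-identityʳ _))
    ; letters↭ = subst (_↭ []) (sym (letters-bar N [])) ↭-refl
    ; codes    = λ 0<v v≤0 → contradiction v≤0 (<⇒≱ 0<v)
    }
  built (suc k) k<n = record
    { squashed = expand-Squashed N d k<N (squashed B)
    ; ends     = expand-EndsInBar N p l t p+t<bars (ends B)
    -- Splitting with `t` uses up the surplus `𝟙 t`, while the pattern of `w` is split with `t′`;
    -- the difference is the new surplus `𝟙 t′`.
    ; count    = suc-injective (begin
        suc (bars N (build N c (suc k)))
          ≡⟨ bars-expand N p l t G k<N p<bars ⟩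
        𝟙 l + 𝟙 (not t) + bars N G
          ≡⟨ cong (𝟙 l + 𝟙 (not t) +_) (count B) ⟩
        𝟙 l + 𝟙 (not t) + (bars N (S k) + 𝟙 t)
          ≡⟨ rearrange (𝟙 l) t ⟩
        suc (𝟙 l + bars N (S k))
          ≡⟨ rearrange′ (𝟙 l) t′ ⟨
        𝟙 l + 𝟙 (not t′) + bars N (S k) + 𝟙 t′
          ≡⟨ cong (_+ 𝟙 t′) (bars-expand N p l t′ (S k) k<N crossings<) ⟨
        suc (bars N (expand N (suc k) (c (suc k)) (S k)) + 𝟙 t′)
          ≡⟨ cong (λ W → suc (bars N W + 𝟙 t′)) (expand-squash N false w k<N k∈w (word-unique w↭)) ⟩
        suc (bars N (S (suc k)) + 𝟙 t′) ∎)
    ; letters↭ = ↭-trans (letters-expand N p l t G k<N p<bars)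
                   (↭-trans (prep (suc k) (letters↭ B))
                     (subst (suc k ∷ range 1 k ↭_) (sym (range-∷ʳ 1 k)) (∷↭∷ʳ (suc k) (range 1 k))))
    ; codes    = codes′
    }
    where
    open ≡-Reasoning
    B = built k (<⇒≤ k<n)
    G = build N c k
    d = shiftTops c (suc k)
    p = crossings d
    l = fall d
    t = top d
    t′ = top (c (suc k))
    k<N : suc k < N
    k<N = s≤s k<n
    k∈w = word-∈ w↭ (s≤s z≤n) k<n
    crossings< : p < bars N (S k)
    crossings< = crossings<bars N false w k<N k∈w
    -- The pattern of `w` has more than `p` bars, and the surplus makes up for `𝟙 t`; this is the
    -- bound that saves the final bar.
    p+t<bars : p + 𝟙 t < bars N G
    p+t<bars = subst (p + 𝟙 t <_) (sym (count B)) (+-monoˡ-< (𝟙 t) crossings<)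
    p<bars : p < bars N G
    p<bars = ≤-<-trans (m≤m+n p (𝟙 t)) p+t<bars
    rearrange : ∀ a t {b} → a + 𝟙 (not t) + (b + 𝟙 t) ≡ suc (a + b)
    rearrange a true  {b} rewrite +-identityʳ a | +-comm b 1 = +-suc a b
    rearrange a false {b} rewrite +-identityʳ b | +-comm a 1 = refl
    rearrange′ : ∀ a t {b} → a + 𝟙 (not t) + b + 𝟙 t ≡ suc (a + b)
    rearrange′ a t {b} = trans (+-assoc (a + 𝟙 (not t)) b (𝟙 t)) (rearrange a t)
    codes′ : ∀ {v} → 0 < v → v ≤ suc k → code v false (build N c (suc k)) ≡ shiftTops c v
    codes′ {v} 0<v v≤ with v ≟ suc k
    ... | yes refl = code-expand-self N p l t k<N (squashed B) p<bars
    ... | no v≢k   = trans (code-expand N false d G v<k k<N) (codes B 0<v (≤-pred v<k))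
      where v<k = ≤∧≢⇒< v≤ v≢k

  shiftedWord : List ℕ
  shiftedWord = letters N (build N c n)

  private
    final : Built n (build N c n)
    final = built n ≤-refl

  shiftedWord-↭ : shiftedWord ↭ range 1 n
  shiftedWord-↭ = letters↭ final

  private
    -- At threshold `n + 1` the word `w` has no bars, so only the surplus is left.
    count≡ : bars N (build N c n) ≡ 𝟙 (top (c n))
    count≡ = trans (count final) (cong (_+ 𝟙 (top (c n)))
      (trans (cong (bars N) (squash-bounded N false (word-bounded w↭))) (bars-bounded (word-bounded w↭))))

    𝟙-positive : ∀ {b m} → m ≡ 𝟙 b → 0 < m → b ≡ true
    𝟙-positive {true}  _    _  = refl
    𝟙-positive {false} refl ()

  -- The final bar has survived, so the number of bars, which is this bit, is positive.
  top-last : top (c n) ≡ true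
  top-last = 𝟙-positive count≡ (0<bars N (ends final))

  -- The only remaining bar is the final one, and `N` is both the bar and the letter `n + 1`. The
  -- finished pattern is therefore the new word followed by `n + 1`.
  code-shiftedWord : ∀ {v} → 0 < v → v ≤ n → code v false (shiftedWord ++ N ∷ []) ≡ shiftTops c v
  code-shiftedWord {v} 0<v v≤n =
    trans (cong (code v false) (sym (split-last-bar N (ends final) (trans count≡ (cong 𝟙 top-last)))))
          (codes final 0<v v≤n)

-- Recoils, descent tops and crossings read off the codes

segments-cong : ∀ {D D′} p c k → (∀ {v} → p ≤ v → v < p + k → v ∈ D ⇔ v ∈ D′) →
                segments D p c k ≡ segments D′ p c k
segments-cong p c zero eq = refl
segments-cong {D} {D′} p c (suc k) eq
  rewrite does-⇔ (eq ≤-refl (m<m+n p (s≤s z≤n))) (p ∈? D) (p ∈? D′) =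
  cong₂ (if does (p ∈? D′) then_else_) (cong (c ∷_) (tail 1)) (tail (suc c))
  where
  tail : ∀ c → segments D (suc p) c k ≡ segments D′ (suc p) c k
  tail c = segments-cong (suc p) c k
    (λ {v} p<v v< → eq (<⇒≤ p<v) (subst (v <_) (sym (+-suc p k)) v<))

withDescentSet-cong : ∀ n {D D′} → (∀ {v} → 0 < v → v < n → v ∈ D ⇔ v ∈ D′) →
                      withDescentSet n D ≡ withDescentSet n D′
withDescentSet-cong zero    eq = refl
withDescentSet-cong (suc m) eq = parts-injective (segments-cong 1 1 m eq)

-- The letter before the list is larger than `v`; going on from there, either the letters fall below
-- `v` before `v` is reached, which is a crossing, or `v` comes directly after a larger letter.
fall-positive : ∀ {v} w → v ∈ w → 0 < crossings (code v true w) + 𝟙 (fall (code v true w))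
fall-positive {v} (x ∷ w) v∈ with <-cmp x v
... | tri< _ _ _   = s≤s z≤n
... | tri≈ _ _ _   = s≤s z≤n
... | tri> _ x≢v _ = fall-positive w (Any.tail (x≢v ∘ sym) v∈)

module _ {f g : ℕ → ℕ} where

  Inverts : ℕ → Set
  Inverts i = g (f i) ≡ i

  position-≤ : ∀ {v} a m → All Inverts (range a m) → v ∈ map f (range a m) → a ≤ g v
  position-≤ a m inv v∈ with i , i∈ , refl ← ∈-map⁻ f v∈ =
    subst (a ≤_) (sym (All.lookup inv i∈)) (proj₁ (∈-range⁻ a m i∈))

  -- Other letters compare alike with `v` and `v + 1`, so both scans agree until the first of the
  -- two is met. If it is `v`, then `v + 1` still gains a crossing whenever `v` has a fall. If it is
  -- `v + 1`, then `v` gains a crossing or a fall by `fall-positive`.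
  precedes-code : ∀ v b a m → All Inverts (range a m) →
    v ∈ map f (range a m) → suc v ∈ map f (range a m) →
    g (suc v) < g v ⇔
    crossings (code (suc v) b (map f (range a m))) <
      crossings (code v b (map f (range a m))) + 𝟙 (fall (code v b (map f (range a m))))
  precedes-code v b a (suc m) (inv ∷ invs) v∈ sv∈ with <-cmp (f a) v
  ... | tri< fa<v fa≢v _
    rewrite code-< b (map f (range (suc a) m)) (m<n⇒m<1+n fa<v)
          | +-assoc (𝟙 b) (crossings (code v false (map f (range (suc a) m)))) (𝟙 (fall (code v false (map f (range (suc a) m))))) =
    mk⇔ (+-monoʳ-< (𝟙 b) ∘ Equivalence.to ih) (Equivalence.from ih ∘ +-cancelˡ-< (𝟙 b) _ _)
    where
    ih = precedes-code v false (suc a) m invs (Any.tail (fa≢v ∘ sym) v∈)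
           (Any.tail (λ eq → <⇒≢ (m<n⇒m<1+n fa<v) (sym eq)) sv∈)
  ... | tri≈ _ fa≡v _
    rewrite code-< b (map f (range (suc a) m)) (s≤s (≤-reflexive fa≡v)) =
    mk⇔ (λ lt → contradiction lt (≤⇒≯ (≤-trans (≤-reflexive (trans (cong g (sym fa≡v)) inv)) (<⇒≤ later))))
        (λ lt → contradiction lt (≤⇒≯ (m≤m+n (𝟙 b) _)))
    where
    later : a < g (suc v)
    later = position-≤ (suc a) m invs (Any.tail (λ eq → 1+n≢n (trans eq fa≡v)) sv∈)
  ... | tri> _ fa≢v fa>v with <-cmp (f a) (suc v)
  ... | tri< fa<sv _ _ = contradiction fa>v (<⇒≱ fa<sv)
  ... | tri≈ _ fa≡sv _ =
    mk⇔ (λ _ → fall-positive (map f (range (suc a) m)) v∈′)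
        (λ _ → subst (_< g v) (sym (trans (cong g (sym fa≡sv)) inv)) (position-≤ (suc a) m invs v∈′))
    where v∈′ = Any.tail (fa≢v ∘ sym) v∈
  ... | tri> _ fa≢sv _ =
    precedes-code v true (suc a) m invs (Any.tail (fa≢v ∘ sym) v∈) (Any.tail (fa≢sv ∘ sym) sv∈)

  -- The tail `e` serves two cases: it is empty for `GDes⁰`, the word being followed by 0, and it
  -- consists of the last letter and `n + 1` for `GDes`, where the last position is no descent.
  top-code : ∀ {v e} b a m → All Inverts (range a m) →
    (∀ b → top (code v b e) ≡ false) → startsBelow v e ≡ does (f (a + m) <? v) →
    top (code v b (map f (range a m) ++ e)) ≡ true ⇔
    v ∈ map f (filter (λ i → f (i + 1) <? f i) (range a m))
  top-code b a zero _ absent _ = mk⇔ (λ eq → contradiction (trans (sym eq) (absent b)) λ ()) λ ()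
  top-code {v} {e} b a (suc m) (inv ∷ invs) absent next = head (f a ≟ v)
    where
    P? = λ i → f (i + 1) <? f i
    L = map f (range (suc a) m) ++ e
    D = map f (filter P? (range (suc a) m))
    D′ = map f (filter P? (range a (suc m)))
    ih : ∀ b → top (code v b L) ≡ true ⇔ v ∈ D
    ih b = top-code b (suc a) m invs absent (trans next (cong (λ i → does (f i <? v)) (+-suc a m)))
    skip : f a ≢ v → top (code v b (f a ∷ L)) ≡ true ⇔ v ∈ D
    skip fa≢v with <-cmp (f a) v
    ... | tri< _ _ _    = ih false
    ... | tri≈ _ fa≡v _ = contradiction fa≡v fa≢v
    ... | tri> _ _ _    = ih true
    next′ : ∀ m → startsBelow v e ≡ does (f (a + suc m) <? v) →
            startsBelow v (map f (range (suc a) m) ++ e) ≡ does (f (a + 1) <? v)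
    next′ zero    eq = eq
    next′ (suc m) eq = cong (λ i → does (f i <? v)) (+-comm 1 a)
    ∉D : f a ≡ v → v ∉ D
    ∉D refl v∈ with i , i∈ , eq ← ∈-map⁻ f v∈ =
      <⇒≢ (proj₁ (∈-range⁻ (suc a) m i∈′)) (trans (sym inv) (trans (cong g eq) (All.lookup invs i∈′)))
      where i∈′ = proj₁ (∈-filter⁻ P? i∈)
    head : Dec (f a ≡ v) → top (code v b (f a ∷ L)) ≡ true ⇔ v ∈ D′
    head (no fa≢v) with P? a
    ... | yes descent rewrite filter-accept P? {xs = range (suc a) m} descent =
      mk⇔ (there ∘ Equivalence.to (skip fa≢v)) (Equivalence.from (skip fa≢v) ∘ Any.tail (fa≢v ∘ sym))
    ... | no ascent rewrite filter-reject P? {xs = range (suc a) m} ascent = skip fa≢v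
    head (yes refl) rewrite code-≡ v b L | next′ m next with P? a
    ... | yes descent rewrite filter-accept P? {xs = range (suc a) m} descent | dec-true (P? a) descent =
      mk⇔ (λ _ → here refl) (λ _ → refl)
    ... | no ascent rewrite filter-reject P? {xs = range (suc a) m} ascent | dec-false (P? a) ascent =
      mk⇔ (λ ()) (λ v∈ → contradiction v∈ (∉D refl))

  -- A pair of adjacent positions is examined when the scan reaches the second one: the flag says
  -- whether the first letter exceeds `f j`, and the scan ends on reaching position `j`.
  crossings-count : ∀ {j} a m → All Inverts (range (suc a) m) → j ∈ range (suc a) m →
    length (filter (λ i → (i + 1 <? j) ×-dec (f (i + 1) <? f j) ×-dec (f j <? f i)) (range a (suc m)))
      ≡ crossings (code (f j) (does (f j <? f a)) (map f (range (suc a) m)))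
  crossings-count {j} a (suc m) (inv ∷ invs) j∈ with <-cmp (f (suc a)) (f j)
  ... | tri≈ _ eq _ = cong length (filter-none P? (All.tabulate too-late))
    where
    P? = λ i → (i + 1 <? j) ×-dec (f (i + 1) <? f j) ×-dec (f j <? f i)
    j≡1+a : j ≡ suc a
    j≡1+a = trans (sym (All.lookup (inv ∷ invs) j∈)) (trans (cong g (sym eq)) inv)
    too-late : ∀ {i} → i ∈ range a (2 + m) → ¬ (i + 1 < j × f (i + 1) < f j × f j < f i)
    too-late {i} i∈ (i+1<j , _) rewrite +-comm i 1 | j≡1+a =
      <⇒≱ (≤-pred i+1<j) (proj₁ (∈-range⁻ a (2 + m) i∈))
  ... | tri> ≮ ≢ fa>v
    rewrite filter-reject (λ i → (i + 1 <? j) ×-dec (f (i + 1) <? f j) ×-dec (f j <? f i)) {x = a} {xs = range (suc a) (suc m)}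
              (λ (_ , lt , _) → ≮ (subst (λ i → f i < f j) (+-comm a 1) lt))
          = trans (crossings-count (suc a) m invs (Any.tail (λ { refl → ≢ refl }) j∈))
                  (cong (λ b → crossings (code (f j) b (map f (range (2 + a) m)))) (dec-true (f j <? f (suc a)) fa>v))
  ... | tri< fa<v ≢ ≯ = by (f j <? f a)
    where
    P? = λ i → (i + 1 <? j) ×-dec (f (i + 1) <? f j) ×-dec (f j <? f i)
    j∈′ : j ∈ range (2 + a) m
    j∈′ = Any.tail (λ { refl → ≢ refl }) j∈
    ih : length (filter P? (range (suc a) (suc m))) ≡ crossings (code (f j) false (map f (range (2 + a) m)))
    ih = trans (crossings-count (suc a) m invs j∈′)
               (cong (λ b → crossings (code (f j) b (map f (range (2 + a) m)))) (dec-false (f j <? f (suc a)) ≯))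
    by : (d : Dec (f j < f a)) → length (filter P? (range a (2 + m)))
           ≡ 𝟙 (does d) + crossings (code (f j) false (map f (range (2 + a) m)))
    by (yes v<fa) rewrite filter-accept P? {x = a} {xs = range (suc a) (suc m)}
      (subst (λ i → i < j × f i < f j × f j < f a) (+-comm 1 a)
        (proj₁ (∈-range⁻ (2 + a) m j∈′) , fa<v , v<fa)) = cong suc ih
    by (no v≮fa) rewrite filter-reject P? {x = a} {xs = range (suc a) (suc m)} (λ (_ , _ , lt) → v≮fa lt) = ih

-- Permutations as words

-- Pigeonhole principle: deleting the first entry of `ys` from `xs` keeps the inclusion, since the
-- later entries differ from it, and the length bound leaves nothing of `xs` at the end.
unique-⊆-↭ : ∀ {A : Set} {xs ys : List A} → Unique ys → (∀ {y} → y ∈ ys → y ∈ xs) →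
             length xs ≤ length ys → ys ↭ xs
unique-⊆-↭ {xs = []}    [] _ _ = ↭-refl
unique-⊆-↭ {xs = _ ∷ _} [] _ ()
unique-⊆-↭ {xs = xs} {y ∷ ys} (y∉ ∷ u) ⊆xs len with as , bs , refl ← ∈-∃++ (⊆xs (here refl)) =
  ↭-trans (prep y (unique-⊆-↭ u ⊆rest len′)) (↭-sym (shift y as bs))
  where
  ⊆rest : ∀ {z} → z ∈ ys → z ∈ as ++ bs
  ⊆rest z∈ with ∈-++⁻ as (⊆xs (there z∈))
  ... | inj₁ z∈as         = ∈-++⁺ˡ z∈as
  ... | inj₂ (here refl)  = contradiction refl (All.lookup y∉ z∈)
  ... | inj₂ (there z∈bs) = ∈-++⁺ʳ as z∈bs
  len′ : length (as ++ bs) ≤ length ys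
  len′ = ≤-pred (subst (_≤ suc (length ys)) (↭-length (shift y as bs)) len)

length-range : ∀ a k → length (range a k) ≡ k
length-range a zero    = refl
length-range a (suc k) = cong suc (length-range (suc a) k)

lookup-range : ∀ a k i → lookup (range a k) i ≡ a + toℕ i
lookup-range a (suc k) Fin.zero    = sym (+-identityʳ a)
lookup-range a (suc k) (Fin.suc i) = trans (lookup-range (suc a) k i) (sym (+-suc a (toℕ i)))

map-range-lookup : ∀ {A : Set} (f : ℕ → A) a xs → (∀ i → f (a + toℕ i) ≡ lookup xs i) →
                   map f (range a (length xs)) ≡ xs
map-range-lookup f a []       eq = refl
map-range-lookup f a (x ∷ xs) eq = cong₂ _∷_ (trans (cong f (sym (+-identityʳ a))) (eq Fin.zero))
  (map-range-lookup f (suc a) xs (λ i → trans (cong f (sym (+-suc a (toℕ i)))) (eq (Fin.suc i))))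

index : ∀ {n i} → i ∈ range 1 n → ∃ λ (j : Fin n) → i ≡ suc (toℕ j)
index {n} i∈ with ∈-range⁻ 1 n i∈
... | s≤s _ , s≤s i<n = fromℕ< i<n , cong suc (sym (toℕ-fromℕ< i<n))

∈-range-toℕ : ∀ {n} (j : Fin n) → suc (toℕ j) ∈ range 1 n
∈-range-toℕ {n} j = ∈-range⁺ 1 n (s≤s z≤n) (s≤s (toℕ<n j))

module _ {n : ℕ} where

  at-toℕ : ∀ (σ : Permutation′ n) j → σ at suc (toℕ j) ≡ suc (toℕ (σ ⟨$⟩ʳ j))
  at-toℕ σ j with toℕ j <? n
  ... | yes j<n = cong (suc ∘ toℕ ∘ (σ ⟨$⟩ʳ_)) (fromℕ<-toℕ j j<n)
  ... | no j≮n  = contradiction (toℕ<n j) j≮n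

  at-end : ∀ (σ : Permutation′ n) → σ at suc n ≡ 0
  at-end σ with n <? n
  ... | yes n<n = contradiction n<n (<-irrefl refl)
  ... | no _    = refl

  at-∈ : ∀ (σ : Permutation′ n) {i} → i ∈ range 1 n → σ at i ∈ range 1 n
  at-∈ σ i∈ with j , refl ← index i∈ = subst (_∈ range 1 n) (sym (at-toℕ σ j)) (∈-range-toℕ (σ ⟨$⟩ʳ j))

  flip-at : ∀ (σ : Permutation′ n) {i} → i ∈ range 1 n → flip σ at (σ at i) ≡ i
  flip-at σ i∈ with j , refl ← index i∈ =
    trans (cong (flip σ at_) (at-toℕ σ j))
      (trans (at-toℕ (flip σ) (σ ⟨$⟩ʳ j)) (cong (suc ∘ toℕ) (inverseˡ σ)))

  word : Permutation′ n → List ℕ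
  word σ = map (σ at_) (range 1 n)

  word-cong : ∀ {σ ρ : Permutation′ n} → σ ≈ ρ → word σ ≡ word ρ
  word-cong {σ} {ρ} σ≈ρ = map-cong-local (All.tabulate at≡)
    where
    at≡ : ∀ {i} → i ∈ range 1 n → σ at i ≡ ρ at i
    at≡ i∈ with j , refl ← index i∈ =
      trans (at-toℕ σ j) (trans (cong (suc ∘ toℕ) (σ≈ρ j)) (sym (at-toℕ ρ j)))

  word-injective : ∀ {σ ρ : Permutation′ n} → word σ ≡ word ρ → σ ≈ ρ
  word-injective {σ} {ρ} eq j = toℕ-injective (suc-injective (begin
    suc (toℕ (σ ⟨$⟩ʳ j)) ≡⟨ at-toℕ σ j ⟨
    σ at suc (toℕ j)     ≡⟨ map-≡ eq (∈-range-toℕ j) ⟩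
    ρ at suc (toℕ j)     ≡⟨ at-toℕ ρ j ⟩
    suc (toℕ (ρ ⟨$⟩ʳ j)) ∎))
    where
    open ≡-Reasoning
    map-≡ : ∀ {f g : ℕ → ℕ} {xs} → map f xs ≡ map g xs → ∀ {x} → x ∈ xs → f x ≡ g x
    map-≡ {xs = _ ∷ _} eq (here refl) = ∷-injectiveˡ eq
    map-≡ {xs = _ ∷ _} eq (there x∈)  = map-≡ (∷-injectiveʳ eq) x∈

  word-↭ : ∀ (σ : Permutation′ n) → word σ ↭ range 1 n
  word-↭ σ = ↭-sym (unique-⊆-↭ (range-unique 1 n)
    (λ v∈ → subst (_∈ word σ) (flip-at (flip σ) v∈) (∈-map⁺ (σ at_) (at-∈ (flip σ) v∈)))
    (≤-reflexive (length-map (σ at_) (range 1 n))))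

  -- A rearrangement of `range 1 n` into `w` matches the indices of the two lists; the casts
  -- identify both index sets with `Fin n`.
  realise : ∀ {w} → w ↭ range 1 n → ∃ λ (σ : Permutation′ n) → word σ ≡ w
  realise {w} w↭ = σ , trans (cong (map (σ at_) ∘ range 1) (sym |w|≡n)) (map-range-lookup (σ at_) 1 w at-lookup)
    where
    |w|≡n : length w ≡ n
    |w|≡n = trans (↭-length w↭) (length-range 1 n)
    π = onIndices (↭⇒↭ₛ w↭)
    σ : Permutation′ n
    σ = cast-id (sym |w|≡n) ∘ₚ π ∘ₚ cast-id (length-range 1 n)
    at-lookup : ∀ i → σ at suc (toℕ i) ≡ lookup w i
    at-lookup i = begin
      σ at suc (toℕ i)
        ≡⟨ cong (λ i → σ at suc i) (toℕ-cast |w|≡n i) ⟨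
      σ at suc (toℕ (cast |w|≡n i))
        ≡⟨ at-toℕ σ (cast |w|≡n i) ⟩
      suc (toℕ (cast (length-range 1 n) (π ⟨$⟩ʳ cast (sym |w|≡n) (cast |w|≡n i))))
        ≡⟨ cong suc (toℕ-cast (length-range 1 n) _) ⟩
      suc (toℕ (π ⟨$⟩ʳ cast (sym |w|≡n) (cast |w|≡n i)))
        ≡⟨ cong (suc ∘ toℕ ∘ (π ⟨$⟩ʳ_)) (cast-involutive (sym |w|≡n) |w|≡n i) ⟩
      suc (toℕ (π ⟨$⟩ʳ i))
        ≡⟨ lookup-range 1 n (π ⟨$⟩ʳ i) ⟨
      lookup (range 1 n) (π ⟨$⟩ʳ i)
        ≡⟨ onIndices-lookup (↭⇒↭ₛ w↭) i ⟨
      lookup w i ∎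
      where open ≡-Reasoning

-- Counting pairs by their second component

length-filter-∷ : ∀ {A : Set} {P : A → Set} (P? : Decidable P) x xs →
                  length (filter P? (x ∷ xs)) ≡ 𝟙 (does (P? x)) + length (filter P? xs)
length-filter-∷ P? x xs with does (P? x)
... | true  = refl
... | false = refl

sum-map-+ : ∀ {B : Set} (f g : B → ℕ) ys → sum (map (λ y → f y + g y) ys) ≡ sum (map f ys) + sum (map g ys)
sum-map-+ f g []       = refl
sum-map-+ f g (y ∷ ys) = trans (cong (f y + g y +_) (sum-map-+ f g ys)) (interchange (f y) (g y) _ _)

module _ {A B : Set} {P : A × B → Set} (P? : Decidable P) where

  length-filter-row : ∀ x ys → length (filter P? (map (x ,_) ys)) ≡ sum (map (λ y → 𝟙 (does (P? (x , y)))) ys)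
  length-filter-row x []       = refl
  length-filter-row x (y ∷ ys) =
    trans (length-filter-∷ P? (x , y) (map (x ,_) ys)) (cong (𝟙 (does (P? (x , y))) +_) (length-filter-row x ys))

  length-filter-cartesianProduct : ∀ xs ys →
    length (filter P? (cartesianProduct xs ys)) ≡ sum (map (λ y → length (filter (λ x → P? (x , y)) xs)) ys)
  length-filter-cartesianProduct [] ys = sym (sum-zeros ys)
    where
    sum-zeros : ∀ ys → sum (map (λ (_ : B) → 0) ys) ≡ 0
    sum-zeros []       = refl
    sum-zeros (_ ∷ ys) = sum-zeros ys
  length-filter-cartesianProduct (x ∷ xs) ys = begin
    length (filter P? (map (x ,_) ys ++ cartesianProduct xs ys))
      ≡⟨ cong length (filter-++ P? (map (x ,_) ys) (cartesianProduct xs ys)) ⟩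
    length (filter P? (map (x ,_) ys) ++ filter P? (cartesianProduct xs ys))
      ≡⟨ length-++ (filter P? (map (x ,_) ys)) ⟩
    length (filter P? (map (x ,_) ys)) + length (filter P? (cartesianProduct xs ys))
      ≡⟨ cong₂ _+_ (length-filter-row x ys) (length-filter-cartesianProduct xs ys) ⟩
    sum (map (λ y → 𝟙 (does (P? (x , y)))) ys) + sum (map (λ y → length (filter (λ x → P? (x , y)) xs)) ys)
      ≡⟨ sum-map-+ _ _ ys ⟨
    sum (map (λ y → 𝟙 (does (P? (x , y))) + length (filter (λ x → P? (x , y)) xs)) ys)
      ≡⟨ cong sum (map-cong (λ y → length-filter-∷ (λ x → P? (x , y)) x xs) ys) ⟨
    sum (map (λ y → length (filter (λ x → P? (x , y)) (x ∷ xs))) ys) ∎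
    where open ≡-Reasoning

-- The three statistics in terms of codes

Stat : ℕ → Set
Stat n = Composition n × Composition n × ℕ

-- The first component is the recoil criterion of `precedes-code`; the second becomes `GC⁰` or `GC`
-- according to the codes supplied.
stat : ∀ n → (ℕ → Code) → Stat n
stat n c =
    withDescentSet n (filter (λ v → crossings (c (suc v)) <? crossings (c v) + 𝟙 (fall (c v))) (range 1 (n ∸ 1)))
  , withDescentSet n (filter (λ v → top (c v) Bool.≟ true) (range 1 (n ∸ 1)))
  , sum (map (crossings ∘ c) (range 1 n))

codes⁰ : List ℕ → ℕ → Code
codes⁰ w v = code v false w

-- The codes of w ++ [ n + 1 ], with the tops moved back by one: w followed by
-- n + 1 has the descent tops counted by GDes, w alone those counted by GDes⁰.

codes⁺ : ℕ → List ℕ → ℕ → Code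
codes⁺ n w v = record (code v false w) { top = top (code (suc v) false (w ++ suc n ∷ [])) }

∈-filter-⇔ : ∀ {A : Set} {P : A → Set} (P? : Decidable P) {x} {xs : List A} → x ∈ xs → P x ⇔ x ∈ filter P? xs
∈-filter-⇔ P? {xs = xs} x∈ = mk⇔ (∈-filter⁺ P? x∈) (proj₂ ∘ ∈-filter⁻ P? {xs = xs})

module _ {m : ℕ} (σ : Permutation′ (suc m)) where

  private
    n = suc m
    f = σ at_
    g = flip σ at_
    inverts : All (λ i → g (f i) ≡ i) (range 1 n)
    inverts = All.tabulate (flip-at σ)
    ∈word : ∀ {v} → 0 < v → v ≤ n → v ∈ word σ
    ∈word = word-∈ (word-↭ σ)

  Rec-code : Rec σ ≡ proj₁ (stat n (codes⁰ (word σ)))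
  Rec-code = withDescentSet-cong n λ {v} 0<v v<n →
    let v∈ = ∈-range⁺ 1 m 0<v v<n in
    ⇔-trans (⇔-sym (∈-filter-⇔ (λ i → g (i + 1) <? g i) v∈))
      (⇔-trans (recoil-code 0<v v<n)
        (∈-filter-⇔ (λ i → crossings (c (suc i)) <? crossings (c i) + 𝟙 (fall (c i))) v∈))
    where
    c = codes⁰ (word σ)
    recoil-code : ∀ {v} → 0 < v → v < n → g (v + 1) < g v ⇔ crossings (c (suc v)) < crossings (c v) + 𝟙 (fall (c v))
    recoil-code {v} 0<v v<n rewrite +-comm v 1 =
      precedes-code {f = f} {g = g} v false 1 n inverts (∈word 0<v (<⇒≤ v<n)) (∈word (s≤s z≤n) v<n)

  tot-code : tot σ ≡ sum (map (crossings ∘ codes⁰ (word σ)) (range 1 n))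
  tot-code = begin
    tot σ
      ≡⟨ length-filter-cartesianProduct (λ (i , j) → P? j i) (range 1 n) (range 1 n) ⟩
    sum (map (λ j → length (filter (P? j) (range 1 n))) (range 1 n))
      ≡⟨ cong sum (map-cong-local (All.tabulate λ {j} j∈ →
           -- Position 0 is added in front. It holds the letter 0, so it contributes no pair and
           -- starts the scan with the flag `false`.
           trans (sym (cong length (filter-reject (P? j) {x = 0} {xs = range 1 n} λ ())))
                 (crossings-count {f = f} {g = g} 0 n inverts j∈))) ⟩
    sum (map (crossings ∘ codes⁰ (word σ) ∘ f) (range 1 n))
      ≡⟨ cong sum (map-∘ (range 1 n)) ⟩
    -- From a sum over positions to a sum over values.
    sum (map (crossings ∘ codes⁰ (word σ)) (word σ))
      ≡⟨ sum-↭ (map⁺ (crossings ∘ codes⁰ (word σ)) (word-↭ σ)) ⟩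
    sum (map (crossings ∘ codes⁰ (word σ)) (range 1 n)) ∎
    where
    open ≡-Reasoning
    P? = λ j i → (i + 1 <? j) ×-dec (f (i + 1) <? f j) ×-dec (f j <? f i)

  GC⁰-code : GC⁰ σ ≡ proj₁ (proj₂ (stat n (codes⁰ (word σ))))
  GC⁰-code = withDescentSet-cong n λ {v} 0<v v<n →
    ⇔-trans
      (mk⇔ (proj₁ ∘ ∈-filter⁻ (λ d → ¬? (d ≟ n)) {xs = GDes⁰ σ})
           (λ v∈ → ∈-filter⁺ (λ d → ¬? (d ≟ n)) v∈ (<⇒≢ v<n)))
      (⇔-trans (⇔-sym (top⇔ 0<v))
        (∈-filter-⇔ (λ i → top (codes⁰ (word σ) i) Bool.≟ true) (∈-range⁺ 1 m 0<v v<n)))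
    where
    top⇔ : ∀ {v} → 0 < v → top (codes⁰ (word σ) v) ≡ true ⇔ v ∈ GDes⁰ σ
    top⇔ {v} 0<v = subst (λ w → top (code v false w) ≡ true ⇔ v ∈ GDes⁰ σ) (++-identityʳ (word σ))
      (top-code {f = f} {g = g} false 1 n inverts (λ _ → refl)
        (sym (dec-true (f (suc n) <? v) (subst (_< v) (sym (at-end σ)) 0<v))))

  GC-code : GC σ ≡ proj₁ (proj₂ (stat n (codes⁺ n (word σ))))
  GC-code = withDescentSet-cong n λ {v} 0<v v<n →
    ⇔-trans (mk⇔ (to v) (∈-map⁺ (_∸ 1)))
      (⇔-trans (⇔-sym (top⇔ v<n))
        (∈-filter-⇔ (λ i → top (codes⁺ n (word σ) i) Bool.≟ true) (∈-range⁺ 1 m 0<v v<n)))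
    where
    ⊆ : ∀ {i} → i ∈ range 1 m → i ∈ range 1 n
    ⊆ i∈ with 0<i , i<n ← ∈-range⁻ 1 m i∈ = ∈-range⁺ 1 n 0<i (m<n⇒m<1+n i<n)
    -- Members of `GDes σ` are positive, so the truncated subtraction can be undone.
    to : ∀ v → v ∈ map (_∸ 1) (GDes σ) → suc v ∈ GDes σ
    to v v∈ with d , d∈ , refl ← ∈-map⁻ (_∸ 1) v∈ with i , i∈ , refl ← ∈-map⁻ f d∈ =
      subst (_∈ GDes σ) (sym (m+[n∸m]≡n (proj₁ (∈-range⁻ 1 n (at-∈ σ (⊆ (proj₁ (∈-filter⁻ (λ i → f (i + 1) <? f i) {xs = range 1 m} i∈)))))))) d∈
    split : map f (range 1 m) ++ f n ∷ suc n ∷ [] ≡ word σ ++ suc n ∷ []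
    split = begin
      map f (range 1 m) ++ f n ∷ suc n ∷ []           ≡⟨ ++-assoc (map f (range 1 m)) (f n ∷ []) (suc n ∷ []) ⟨
      (map f (range 1 m) ++ f n ∷ []) ++ suc n ∷ []   ≡⟨ cong (_++ suc n ∷ []) (map-++ f (range 1 m) (n ∷ [])) ⟨
      map f (range 1 m ++ n ∷ []) ++ suc n ∷ []       ≡⟨ cong (λ r → map f r ++ suc n ∷ []) (range-∷ʳ 1 m) ⟨
      word σ ++ suc n ∷ []                            ∎
      where open ≡-Reasoning
    absent : ∀ {v} b → v < n → top (code (suc v) b (suc n ∷ [])) ≡ false
    absent b v<n = cong top (code-> b [] (s≤s v<n))
    -- Followed by the larger letter `n + 1`, the last letter of `σ` is not a descent top, in
    -- accordance with `GDes`.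
    last-not-top : ∀ {v} → v < n → ∀ b → top (code (suc v) b (f n ∷ suc n ∷ [])) ≡ false
    last-not-top {v} v<n b with <-cmp (f n) (suc v)
    ... | tri< _ _ _ = absent false v<n
    ... | tri≈ _ _ _ = dec-false (suc n <? suc v) (<⇒≯ (s≤s v<n))
    ... | tri> _ _ _ = absent true v<n
    top⇔ : ∀ {v} → v < n → top (codes⁺ n (word σ) v) ≡ true ⇔ suc v ∈ GDes σ
    top⇔ {v} v<n = subst (λ w → top (code (suc v) false w) ≡ true ⇔ suc v ∈ GDes σ) split
      (top-code {f = f} {g = g} false 1 m (All.tabulate λ i∈ → flip-at σ (⊆ i∈)) (last-not-top v<n) refl)

filter-cong-local : ∀ {A : Set} {P Q : A → Set} (P? : Decidable P) (Q? : Decidable Q) {xs} →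
                    All (λ x → does (P? x) ≡ does (Q? x)) xs → filter P? xs ≡ filter Q? xs
filter-cong-local P? Q? [] = refl
filter-cong-local P? Q? {x ∷ xs} (eq ∷ eqs) with does (P? x) | does (Q? x)
filter-cong-local P? Q? {x ∷ xs} (refl ∷ eqs) | true  | true  = cong (x ∷_) (filter-cong-local P? Q? eqs)
filter-cong-local P? Q? {x ∷ xs} (refl ∷ eqs) | false | false = filter-cong-local P? Q? eqs

-- The top flag is left out because e may change it for the last letter of w.

code-++ : ∀ {v} b w e → v ∈ w → record (code v b (w ++ e)) { top = false } ≡ record (code v b w) { top = false }
code-++ {v} b (x ∷ w) e v∈ with <-cmp x v
... | tri< _ x≢v _ = cong (addCrossing b) (code-++ false w e (Any.tail (x≢v ∘ sym) v∈))
... | tri≈ _ _ _   = refl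
... | tri> _ x≢v _ = code-++ true w e (Any.tail (x≢v ∘ sym) v∈)

stat-cong : ∀ m {c c′} →
            (∀ {v} → 0 < v → v ≤ suc m → crossings (c v) ≡ crossings (c′ v) × fall (c v) ≡ fall (c′ v)) →
            (∀ {v} → 0 < v → v ≤ m → top (c v) ≡ top (c′ v)) →
            stat (suc m) c ≡ stat (suc m) c′
stat-cong m {c} {c′} eq eq-top = cong₂ _,_ Rec≡ (cong₂ _,_ GC≡ tot≡)
  where
  n = suc m
  Rec≡ = cong (withDescentSet n) (filter-cong-local
    (λ v → crossings (c (suc v)) <? crossings (c v) + 𝟙 (fall (c v)))
    (λ v → crossings (c′ (suc v)) <? crossings (c′ v) + 𝟙 (fall (c′ v)))
    (All.tabulate λ {v} v∈ →
      let 0<v , v<n = ∈-range⁻ 1 m v∈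
          eqᵖ , eqᶠ = eq 0<v (<⇒≤ v<n)
      in cong₂ (λ a b → does (a <? b)) (proj₁ (eq (s≤s z≤n) v<n)) (cong₂ _+_ eqᵖ (cong 𝟙 eqᶠ))))
  GC≡ = cong (withDescentSet n) (filter-cong-local
    (λ v → top (c v) Bool.≟ true) (λ v → top (c′ v) Bool.≟ true)
    (All.tabulate λ {v} v∈ →
      let 0<v , v<n = ∈-range⁻ 1 m v∈ in cong (λ t → does (t Bool.≟ true)) (eq-top 0<v (≤-pred v<n))))
  tot≡ = cong sum (map-cong-local {f = crossings ∘ c} {g = crossings ∘ c′} (All.tabulate λ {v} v∈ →
    let 0<v , v<1+n = ∈-range⁻ 1 n v∈ in proj₁ (eq 0<v (≤-pred v<1+n))))

-- The injection on permutations and its effect on the statistics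

module _ {m : ℕ} where

  private
    n = suc m
    0<n : 0 < n
    0<n = s≤s z≤n

  -- Unfolding the construction makes type checking intractable.

  abstract
    slide : Permutation′ n → Permutation′ n
    slide σ = proj₁ (realise (shiftedWord-↭ 0<n (word-↭ σ)))

    code-slide : ∀ σ {v} → 0 < v → v ≤ n → code v false (word (slide σ) ++ suc n ∷ []) ≡ shiftTops (codes⁰ (word σ)) v
    code-slide σ {v} 0<v v≤n =
      trans (cong (λ w → code v false (w ++ suc n ∷ [])) (proj₂ (realise (shiftedWord-↭ 0<n (word-↭ σ)))))
            (code-shiftedWord 0<n (word-↭ σ) 0<v v≤n)

  -- The shift forgets only the top bit of `n`, which is `true` for every word by `top-last`.
  slide-injective : ∀ {σ ρ} → word (slide σ) ≡ word (slide ρ) → σ ≈ ρ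
  slide-injective {σ} {ρ} eq = word-injective (code-injective 0<n (word-↭ σ) (word-↭ ρ) codes-≡)
    where
    shifted-≡ : ∀ {v} → 0 < v → v ≤ n → shiftTops (codes⁰ (word σ)) v ≡ shiftTops (codes⁰ (word ρ)) v
    shifted-≡ {v} 0<v v≤n =
      trans (sym (code-slide σ 0<v v≤n)) (trans (cong (λ w → code v false (w ++ suc n ∷ [])) eq) (code-slide ρ 0<v v≤n))
    top-≡ : ∀ {v} → v ≤ n → top (code v false (word σ)) ≡ top (code v false (word ρ))
    top-≡ {v} v≤n with v ≟ n
    ... | yes refl = trans (top-last 0<n (word-↭ σ)) (sym (top-last 0<n (word-↭ ρ)))
    -- The bit of `v` is stored in the shifted code of `v + 1`.
    ... | no v≢n   = cong top (shifted-≡ (s≤s z≤n) (≤∧≢⇒< v≤n v≢n))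
    codes-≡ : ∀ {v} → 0 < v → v ≤ n → code v false (word σ) ≡ code v false (word ρ)
    codes-≡ 0<v v≤n = cong₂ (λ c t → record c { top = t }) (shifted-≡ 0<v v≤n) (top-≡ v≤n)

  stat⁰-word : ∀ σ → (Rec σ , GC⁰ σ , tot σ) ≡ stat n (codes⁰ (word σ))
  stat⁰-word σ = cong₂ _,_ (Rec-code σ) (cong₂ _,_ (GC⁰-code σ) (tot-code σ))

  stat-word : ∀ σ → (Rec σ , GC σ , tot σ) ≡ stat n (codes⁺ n (word σ))
  stat-word σ = cong₂ _,_ (Rec-code σ) (cong₂ _,_ (GC-code σ) (tot-code σ))

  -- The two shifts cancel: `codes⁺` takes for `v` the bit of `v + 1` in the new word, and this is
  -- the bit of `v` in `σ`. The other components are kept by `shiftTops` and, by `code-++`, by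
  -- appending `n + 1`.
  stat-slide : ∀ σ → (Rec σ , GC⁰ σ , tot σ) ≡ stat n (codes⁺ n (word (slide σ)))
  stat-slide σ = trans (stat⁰-word σ) (stat-cong m same (λ 0<v v≤m → sym (cong top (code-slide σ (s≤s z≤n) (s≤s v≤m)))))
    where
    same : ∀ {v} → 0 < v → v ≤ n →
           crossings (code v false (word σ)) ≡ crossings (code v false (word (slide σ))) ×
           fall (code v false (word σ)) ≡ fall (code v false (word (slide σ)))
    same {v} 0<v v≤n = cong crossings eq , cong fall eq
      where
      eq : record (code v false (word σ)) { top = false } ≡ record (code v false (word (slide σ))) { top = false }
      eq = trans (cong (λ c → record c { top = false }) (sym (code-slide σ 0<v v≤n)))
                 (code-++ false (word (slide σ)) (suc n ∷ []) (word-∈ (word-↭ (slide σ)) 0<v v≤n))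

  -- An injective self-map of a finite set is bijective. Words are used because permutations are
  -- compared only up to `_≈_`, whereas words are equal propositionally.
  slide-words-↭ : map (word ∘ slide) (𝔖 n) ↭ map word (𝔖 n)
  slide-words-↭ = unique-⊆-↭
    (AllPairs.map⁺ (AllPairs.map (λ σ≉ρ eq → σ≉ρ (slide-injective eq)) (𝔖-unique n)))
    complete
    (≤-reflexive (trans (length-map word (𝔖 n)) (sym (length-map (word ∘ slide) (𝔖 n)))))
    where
    complete : ∀ {w} → w ∈ map (word ∘ slide) (𝔖 n) → w ∈ map word (𝔖 n)
    complete w∈ with σ , _ , refl ← ∈-map⁻ (word ∘ slide) w∈ =
      Any.map⁺ (Any.map (λ {ρ} → word-cong {σ = slide σ} {ρ}) (𝔖-complete (slide σ)))

  stats-↭ : map (λ σ → (Rec σ , GC⁰ σ , tot σ)) (𝔖 n) ↭ map (λ σ → (Rec σ , GC σ , tot σ)) (𝔖 n)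
  stats-↭ = subst₂ _↭_
    (trans (sym (map-∘ (𝔖 n))) (sym (map-cong stat-slide (𝔖 n))))
    (trans (sym (map-∘ (𝔖 n))) (sym (map-cong stat-word (𝔖 n))))
    (map⁺ (stat n ∘ codes⁺ n) slide-words-↭)

-- Comparison of coefficients

coeff-+ₚ : ∀ f g k → coeff (f +ₚ g) k ≡ coeff f k + coeff g k
coeff-+ₚ []      g       k       = refl
coeff-+ₚ (a ∷ f) []      k       = sym (+-identityʳ _)
coeff-+ₚ (a ∷ f) (b ∷ g) zero    = refl
coeff-+ₚ (a ∷ f) (b ∷ g) (suc k) = coeff-+ₚ f g k

coeff-q^ : ∀ m k → coeff (q^ m) k ≡ 𝟙 (does (m ≟ k))
coeff-q^ zero    zero    = refl
coeff-q^ zero    (suc k) = refl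
coeff-q^ (suc m) zero    = refl
coeff-q^ (suc m) (suc k) = coeff-q^ m k

module _ {n : ℕ} (I J : Composition n) where

  hasStat? : ∀ k → Decidable (λ ((R , G , t) : Stat n) → (R ≡ I × G ≡ J) × t ≡ k)
  hasStat? k (R , G , t) = ((R ≟ᶜ I) ×-dec (G ≟ᶜ J)) ×-dec (t ≟ k)

  -- Each summand is a single power of `q`, so a coefficient counts triples of statistics and
  -- depends only on the multiset of these triples, which `stats-↭` shows to be the same for `GC⁰`
  -- and `GC`.
  coeff-∑ : ∀ {A : Set} (R G : A → Composition n) (t : A → ℕ) xs k →
    coeff (∑ₚ (filter (λ x → (R x ≟ᶜ I) ×-dec (G x ≟ᶜ J)) xs) (λ x → q^ t x)) k
      ≡ length (filter (hasStat? k) (map (λ x → (R x , G x , t x)) xs))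
  coeff-∑ R G t []       k = refl
  coeff-∑ R G t (x ∷ xs) k
    rewrite length-filter-∷ (hasStat? k) (R x , G x , t x) (map (λ x → (R x , G x , t x)) xs)
    with does ((R x ≟ᶜ I) ×-dec (G x ≟ᶜ J))
  ... | false = coeff-∑ R G t xs k
  ... | true  = trans (coeff-+ₚ (q^ t x) _ k) (cong₂ _+_ (coeff-q^ (t x) k) (coeff-∑ R G t xs k))

corollary6p4 : (n : ℕ) → 1 ≤ n → (I J : Composition n) →
    ∑ₚ (filter (λ σ → (Rec σ ≟ᶜ I) ×-dec (GC⁰ σ ≟ᶜ J)) (𝔖 n)) (λ σ → q^ tot σ)
    ≈ₚ
    ∑ₚ (filter (λ σ → (Rec σ ≟ᶜ I) ×-dec (GC σ ≟ᶜ J)) (𝔖 n)) (λ σ → q^ tot σ)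
corollary6p4 (suc m) _ I J k = begin
  _ ≡⟨ coeff-∑ I J Rec GC⁰ tot (𝔖 (suc m)) k ⟩
  _ ≡⟨ ↭-length (filter-↭ (hasStat? I J k) stats-↭) ⟩
  _ ≡⟨ coeff-∑ I J Rec GC tot (𝔖 (suc m)) k ⟨
  _ ∎
  where open ≡-Reasoning
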